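{- Let $A=\{a_1,a_2,\ldots,a_k\}$ be a set of $k\ge1$ distinct positive integers, let $\tau$ be a permutation of $\{1,2,\ldots,k\}$, and let $A_{\tau(j)}=\{a_{\tau(1)},\ldots,a_{\tau(j)}\}$ for $j=1,\ldots,k$, with $A_{\tau(0)}=\emptyset$. Then the following are equivalent: (a) No $2$-element subset of $A$ is relatively prime (i.e. $\gcd(a,b)>1$ for all distinct $a,b\in A$). (b) \[ \sum_{d=1}^{\sup A} \mu(d)\, v(A,d)\,(v(A,d)-1) = 0. \] (c) \[ \sum_{j=1}^k \sum_{d\mid a_{\tau(j)}} \mu(d)\, v(A_{\tau(j-1)},d) = 0. \]
   Context: $\sup A$ is the largest element of $A$. $\mu$ is the Möbius function. For a finite set $X$ of positive integers and a positive integer $d$, $v(X,d)$ is the number of multiples of $d$ in $X$ (so $v(\emptyset,d)=0$). -}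

module Defs where

open import Data.Bool.Base using (if_then_else_)
open import Data.Integer.Base using (ℤ; 0ℤ; -1ℤ) renaming (_+_ to _+ℤ_; _^_ to _^ℤ_)
open import Data.List.Base using (List; applyUpTo; filter; foldr; length; map)
open import Data.Nat.Base using (ℕ; zero; suc)
open import Data.Nat.Divisibility using (_∣?_)
open import Data.Nat.Primality.Factorisation using (factorise; factors)
open import Data.Nat.Properties using (_≟_)
open import Data.List.Relation.Unary.Unique.DecPropositional _≟_ using (unique?)
open import Relation.Nullary.Decidable.Core using (does)

∑ : {A : Set} → List A → (A → ℤ) → ℤ
∑ xs f = foldr _+ℤ_ 0ℤ (map f xs)

infix 6 ∑
syntax ∑ xs (λ x → e) = ∑[ x ∈ xs ] e

-- The list 1, 2, …, n.
[1⋯_] : ℕ → List ℕ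
[1⋯ n ] = applyUpTo suc n

-- The positive divisors of n, for n > 0.
divisors : ℕ → List ℕ
divisors n = filter (_∣? n) [1⋯ n ]

-- `factors (factorise n)` lists the prime factors of n with multiplicity, so
-- it is duplicate-free exactly when n is a product of distinct primes.
-- The value at 0 is a dummy.
μ : ℕ → ℤ
μ zero      = 0ℤ
μ n@(suc _) = if does (unique? ps) then -1ℤ ^ℤ length ps else 0ℤ
  where
  ps : List ℕ
  ps = factors (factorise n)

-- A finite set X is represented by a list of its elements without repetition;
-- on a list with repetitions this would count multiplicities.
v : List ℕ → ℕ → ℕ
v X d = length (filter (d ∣?_) X)

{-# OPTIONS --safe #-}
module Submission where

-- Write c(n, X) for the number of elements of X coprime to n.  From
-- ∑_{d∣n} μ(d) = [n = 1] and v(X, d) = ∑_{x∈X} [d∣x] one gets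
-- ∑_{d∣n} μ(d) v(X, d) = c(n, X).  Hence (c) says that a sum of nonnegative
-- terms, the number of coprime pairs listed in the order τ, vanishes.  Adding x
-- to X changes v(v - 1) by 2 [d∣x] v(X, d), so by induction the sum in (b)
-- is twice the number of coprime pairs of A.
--
-- ∑_{d∣n} μ(d) = 0 for n = p m with p prime: the divisors prime to p are the
-- same for n and for m; the others are the p e with e ∣ m, where μ(p e) is 0
-- if p ∣ e and - μ(e) otherwise, so the two parts cancel.

open import Defs
open import Data.Bool.Base using (true; false; if_then_else_)
open import Data.Fin.Base using (Fin; toℕ; zero; suc) renaming (_<_ to _<ᶠ_)
open import Data.Fin.Permutation using (Permutation′; _⟨$⟩ʳ_; _⟨$⟩ˡ_; inverseʳ; inverseˡ)
open import Data.Fin.Properties using (<-cmp; <⇒≢)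
open import Data.Integer.Base using (+_; 0ℤ; 1ℤ; -1ℤ; _*_; _-_; _+_; -_; ℤ; _^_)
import Data.Integer.Properties as ℤ
open import Data.Integer.Tactic.RingSolver using (solve-∀)
open import Data.List.Base using (List; []; _∷_; allFin; tabulate; take; filter; map; length)
open import Data.List.Extrema.Nat using (max; xs≤max)
open import Data.List.Membership.Propositional using (_∈_; _∉_)
open import Data.List.Membership.Propositional.Properties
  using (∈-filter⁺; ∈-filter⁻; ∈-applyUpTo⁺; ∈-map⁺; ∈-map⁻)
open import Data.List.Membership.Propositional.Properties.WithK using (unique∧set⇒bag)
open import Data.List.Relation.Binary.BagAndSetEquality using (∼bag⇒↭; _∼[_]_; set)
open import Data.List.Relation.Binary.Permutation.Propositional using (_↭_; refl; prep; swap; trans; ↭-sym; ↭⇒↭ₛ)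
open import Data.List.Relation.Binary.Permutation.Propositional.Properties using (↭-length)
open import Data.List.Relation.Unary.All as All using (All; []; _∷_)
import Data.List.Relation.Unary.All.Properties as All
open import Data.List.Relation.Unary.AllPairs using (AllPairs; []; _∷_)
open import Data.List.Relation.Unary.AllPairs.Properties using (tabulate⁺-<)
open import Data.List.Relation.Unary.Any using (here; there)
open import Data.List.Relation.Unary.Unique.Propositional using (Unique)
import Data.List.Relation.Unary.Unique.Propositional.Properties as Unique
open import Data.Nat.Base as ℕ using (ℕ; zero; suc; NonZero; >-nonZero; s≤s; z≤n; _≤_; _<_; _>_)
open import Data.Nat.Coprimality using (Coprime; coprime-divisor)
open import Data.Nat.Divisibility
  using (_∣_; _∣?_; divides; ∣⇒≤; ∣-trans; n∣m*n; m∣m*n; *-cancelˡ-∣; *-monoʳ-∣; 0∣⇒≡0)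
open import Data.Nat.GCD using (gcd; gcd-comm; gcd[m,n]∣m; gcd[m,n]∣n; gcd-greatest; gcd[m,n]≡0⇒m≡0)
open import Data.Nat.Primality using (Prime; prime⇒nonZero; prime⇒irreducible)
open import Data.Nat.Primality.Factorisation
  using (PrimeFactorisation; factorise; factors; factorisationUnique; factorisationHasAllPrimeFactors)
open import Data.Nat.ListAction using (sum; product)
open import Data.Nat.ListAction.Properties using (∈⇒∣product)
import Data.Nat.Properties as ℕ
open import Data.List.Relation.Unary.Unique.DecPropositional ℕ._≟_ using (unique?)
open import Data.Product.Base using (_×_; _,_; proj₂)
open import Data.Sum.Base using (inj₁; inj₂)
open import Function.Base using (_∘_; case_of_)
open import Function.Bundles using (_⇔_; mk⇔; Equivalence)
open import Function.Construct.Composition using (_⇔-∘_)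
open import Function.Construct.Symmetry using (⇔-sym)
open import Function.Definitions using (Injective)
open import Relation.Binary.Definitions using (tri<; tri≈; tri>)
open import Relation.Binary.PropositionalEquality
  using (_≡_; _≢_; refl; sym; cong; cong₂; subst; subst₂; setoid; module ≡-Reasoning)
  renaming (trans to ≡-trans)
open import Relation.Nullary.Decidable using (yes; no; does; ¬?; dec-true; dec-false)
open import Relation.Nullary.Negation using (¬_; contradiction)
open import Relation.Unary using (Pred; Decidable)
open import Data.List.Relation.Binary.Permutation.Setoid.Properties (setoid ℕ) using (Unique-resp-↭)

open Equivalence using (to; from)

private
  variable
    A B : Set

-- Finite sums

∑-cong : ∀ (xs : List A) {f g : A → ℤ} → (∀ {x} → x ∈ xs → f x ≡ g x) → ∑ xs f ≡ ∑ xs g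
∑-cong []       f≡g = refl
∑-cong (x ∷ xs) f≡g = cong₂ _+_ (f≡g (here refl)) (∑-cong xs (f≡g ∘ there))

∑-zero : ∀ (xs : List A) → ∑ xs (λ _ → 0ℤ) ≡ 0ℤ
∑-zero []       = refl
∑-zero (x ∷ xs) = ≡-trans (ℤ.+-identityˡ _) (∑-zero xs)

interchange : ∀ a b c d → (a + b) + (c + d) ≡ (a + c) + (b + d)
interchange = solve-∀

∑-+ : ∀ (xs : List A) (f g : A → ℤ) → ∑[ x ∈ xs ] (f x + g x) ≡ ∑ xs f + ∑ xs g
∑-+ []       f g = refl
∑-+ (x ∷ xs) f g = begin
  (f x + g x) + (∑[ y ∈ xs ] (f y + g y)) ≡⟨ cong (_+_ (f x + g x)) (∑-+ xs f g) ⟩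
  (f x + g x) + (∑ xs f + ∑ xs g)         ≡⟨ interchange (f x) (g x) (∑ xs f) (∑ xs g) ⟩
  (f x + ∑ xs f) + (g x + ∑ xs g)         ∎
  where open ≡-Reasoning

∑-*ˡ : ∀ (xs : List A) c (f : A → ℤ) → ∑[ x ∈ xs ] (c * f x) ≡ c * ∑ xs f
∑-*ˡ []       c f = sym (ℤ.*-zeroʳ c)
∑-*ˡ (x ∷ xs) c f = ≡-trans (cong (_+_ (c * f x)) (∑-*ˡ xs c f)) (sym (ℤ.*-distribˡ-+ c (f x) _))

∑-neg : ∀ (xs : List A) (f : A → ℤ) → ∑[ x ∈ xs ] (- f x) ≡ - ∑ xs f
∑-neg []       f = refl
∑-neg (x ∷ xs) f = ≡-trans (cong (_+_ (- f x)) (∑-neg xs f)) (sym (ℤ.neg-distrib-+ (f x) _))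

∑-map : ∀ (h : A → B) xs (f : B → ℤ) → ∑ (map h xs) f ≡ ∑ xs (f ∘ h)
∑-map h []       f = refl
∑-map h (x ∷ xs) f = cong (_+_ (f (h x))) (∑-map h xs f)

∑-↭ : ∀ {xs ys : List A} (f : A → ℤ) → xs ↭ ys → ∑ xs f ≡ ∑ ys f
∑-↭ f refl        = refl
∑-↭ f (prep x p)  = cong (_+_ (f x)) (∑-↭ f p)
∑-↭ f (swap {xs} {ys} x y p) = begin
  f x + (f y + ∑ xs f) ≡⟨ ℤ.+-assoc (f x) (f y) _ ⟨
  (f x + f y) + ∑ xs f ≡⟨ cong₂ _+_ (ℤ.+-comm (f x) (f y)) (∑-↭ f p) ⟩
  (f y + f x) + ∑ ys f ≡⟨ ℤ.+-assoc (f y) (f x) _ ⟩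
  f y + (f x + ∑ ys f) ∎
  where open ≡-Reasoning
∑-↭ f (trans p q) = ≡-trans (∑-↭ f p) (∑-↭ f q)

-- Two duplicate-free lists with the same members are permutations of each other, so every later
-- change of summation range reduces to two membership proofs.
∑-set : ∀ {xs ys : List A} (f : A → ℤ) → Unique xs → Unique ys → xs ∼[ set ] ys → ∑ xs f ≡ ∑ ys f
∑-set f xs! ys! xs∼ys = ∑-↭ f (∼bag⇒↭ (unique∧set⇒bag xs! ys! xs∼ys))

-- Trades a restricted range for an indicator. Indicators arise when an element is added to `X`;
-- restricted ranges can be compared by `∑-set`.
∑-filter : ∀ {p} {P : Pred A p} (P? : Decidable P) xs (f : A → ℤ) →
  ∑ (filter P? xs) f ≡ ∑[ x ∈ xs ] (if does (P? x) then f x else 0ℤ)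
∑-filter P? []       f = refl
∑-filter P? (x ∷ xs) f with does (P? x)
... | true  = cong (_+_ (f x)) (∑-filter P? xs f)
... | false = ≡-trans (∑-filter P? xs f) (sym (ℤ.+-identityˡ _))

module _ {p} {P : Pred A p} (P? : Decidable P) where

  ∑-split : ∀ xs (f : A → ℤ) → ∑ xs f ≡ ∑ (filter P? xs) f + ∑ (filter (¬? ∘ P?) xs) f
  ∑-split xs f = begin
    ∑ xs f
      ≡⟨ ∑-cong xs (λ {x} _ → pointwise x) ⟩
    ∑[ x ∈ xs ] ((if does (P? x) then f x else 0ℤ) + (if does (¬? (P? x)) then f x else 0ℤ))
      ≡⟨ ∑-+ xs _ _ ⟩
    (∑[ x ∈ xs ] (if does (P? x) then f x else 0ℤ)) + (∑[ x ∈ xs ] (if does (¬? (P? x)) then f x else 0ℤ))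
      ≡⟨ cong₂ _+_ (∑-filter P? xs f) (∑-filter (¬? ∘ P?) xs f) ⟨
    ∑ (filter P? xs) f + ∑ (filter (¬? ∘ P?) xs) f
      ∎
    where
    open ≡-Reasoning
    pointwise : ∀ x → f x ≡ (if does (P? x) then f x else 0ℤ) + (if does (¬? (P? x)) then f x else 0ℤ)
    pointwise x with does (P? x)
    ... | true  = sym (ℤ.+-identityʳ _)
    ... | false = sym (ℤ.+-identityˡ _)

  length-filter≡0⇔ : ∀ xs → length (filter P? xs) ≡ 0 ⇔ All (λ x → ¬ P x) xs
  length-filter≡0⇔ []       = mk⇔ (λ _ → []) (λ _ → refl)
  length-filter≡0⇔ (x ∷ xs) with P? x
  ... | yes px = mk⇔ (λ ()) (λ { (¬px ∷ _) → contradiction px ¬px })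
  ... | no ¬px = mk⇔ (λ eq → ¬px ∷ to (length-filter≡0⇔ xs) eq) (λ { (_ ∷ ¬ps) → from (length-filter≡0⇔ xs) ¬ps })

  length-filter-∷ : ∀ x xs →
    + length (filter P? (x ∷ xs)) ≡ (if does (P? x) then 1ℤ else 0ℤ) + + length (filter P? xs)
  length-filter-∷ x xs with does (P? x)
  ... | true  = refl
  ... | false = refl

-- Moves a sum of nonnegative integers into `ℕ`, where nothing can cancel and a zero sum forces
-- every term to be zero.
∑-pos : ∀ (xs : List A) (f : A → ℕ) → ∑[ x ∈ xs ] (+ f x) ≡ + sum (map f xs)
∑-pos []       f = refl
∑-pos (x ∷ xs) f = cong (_+_ (+ f x)) (∑-pos xs f)

sum≡0⇔All≡0 : ∀ ns → sum ns ≡ 0 ⇔ All (_≡ 0) ns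
sum≡0⇔All≡0 []       = mk⇔ (λ _ → []) (λ _ → refl)
sum≡0⇔All≡0 (n ∷ ns) = mk⇔
  (λ Σ≡0 → ℕ.m+n≡0⇒m≡0 n Σ≡0 ∷ to (sum≡0⇔All≡0 ns) (ℕ.m+n≡0⇒n≡0 n Σ≡0))
  (λ { (refl ∷ ns≡0) → from (sum≡0⇔All≡0 ns) ns≡0 })

-- Lists of divisors

∈-[1⋯]⁺ : ∀ {d n} → 0 < d → d ≤ n → d ∈ [1⋯ n ]
∈-[1⋯]⁺ {suc d} _ d≤n = ∈-applyUpTo⁺ suc d≤n

[1⋯]⁺ : ∀ n → Unique [1⋯ n ]
[1⋯]⁺ n = Unique.applyUpTo⁺₁ suc n (λ i<j _ → ℕ.<⇒≢ i<j ∘ ℕ.suc-injective)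

∣⇒>0 : ∀ {d n} .{{_ : NonZero n}} → d ∣ n → 0 < d
∣⇒>0 {zero}  {suc n} d∣n = contradiction (0∣⇒≡0 d∣n) λ ()
∣⇒>0 {suc d} _   = s≤s z≤n

∈-divisors⁺ : ∀ {d n} .{{_ : NonZero n}} → d ∣ n → d ∈ divisors n
∈-divisors⁺ {n = n} d∣n = ∈-filter⁺ (_∣? n) (∈-[1⋯]⁺ (∣⇒>0 d∣n) (∣⇒≤ d∣n)) d∣n

∈-divisors⁻ : ∀ {d n} → d ∈ divisors n → d ∣ n
∈-divisors⁻ {n = n} = proj₂ ∘ ∈-filter⁻ (_∣? n) {xs = [1⋯ n ]}

divisors⁺ : ∀ n → Unique (divisors n)
divisors⁺ n = Unique.filter⁺ (_∣? n) ([1⋯]⁺ n)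

gcd≢0 : ∀ m n .{{_ : NonZero m}} → NonZero (gcd m n)
gcd≢0 m n = ℕ.≢-nonZero (ℕ.≢-nonZero⁻¹ m ∘ gcd[m,n]≡0⇒m≡0)

-- The common divisors of `m` and `n` are the divisors of their gcd, which is nonzero because `m`
-- is.
∑-divisors-gcd : ∀ m n .{{_ : NonZero m}} (f : ℕ → ℤ) →
  ∑[ d ∈ divisors m ] (if does (d ∣? n) then f d else 0ℤ) ≡ ∑ (divisors (gcd m n)) f
∑-divisors-gcd m n f = ≡-trans (sym (∑-filter (_∣? n) (divisors m) f))
  (∑-set f (Unique.filter⁺ (_∣? n) (divisors⁺ m)) (divisors⁺ (gcd m n)) (mk⇔ ⇒ ⇐))
  where
  instance
    g≢0 : NonZero (gcd m n)
    g≢0 = gcd≢0 m n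
  ⇒ : ∀ {d} → d ∈ filter (_∣? n) (divisors m) → d ∈ divisors (gcd m n)
  ⇒ d∈ with d∈m , d∣n ← ∈-filter⁻ (_∣? n) {xs = divisors m} d∈ =
    ∈-divisors⁺ {n = gcd m n} (gcd-greatest (∈-divisors⁻ {n = m} d∈m) d∣n)
  ⇐ : ∀ {d} → d ∈ divisors (gcd m n) → d ∈ filter (_∣? n) (divisors m)
  ⇐ d∈ = ∈-filter⁺ (_∣? n)
    (∈-divisors⁺ (∣-trans (∈-divisors⁻ d∈) (gcd[m,n]∣m m n)))
    (∣-trans (∈-divisors⁻ d∈) (gcd[m,n]∣n m n))

-- Since `n ≤ m`, the range up to `m` contains every divisor of `n`. This links the range up to the
-- maximum in (b) to the divisors of a single element.
∑-[1⋯]-∣ : ∀ {m n} .{{_ : NonZero n}} → n ≤ m → (f : ℕ → ℤ) →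
  ∑[ d ∈ [1⋯ m ] ] (if does (d ∣? n) then f d else 0ℤ) ≡ ∑ (divisors n) f
∑-[1⋯]-∣ {m} {n} n≤m f = ≡-trans (sym (∑-filter (_∣? n) [1⋯ m ] f))
  (∑-set f (Unique.filter⁺ (_∣? n) ([1⋯]⁺ m)) (divisors⁺ n) (mk⇔
    (λ d∈ → ∈-divisors⁺ (proj₂ (∈-filter⁻ (_∣? n) {xs = [1⋯ m ]} d∈)))
    (λ d∈ → let d∣n = ∈-divisors⁻ d∈ in
      ∈-filter⁺ (_∣? n) (∈-[1⋯]⁺ (∣⇒>0 d∣n) (ℕ.≤-trans (∣⇒≤ d∣n) n≤m)) d∣n)))

-- The Möbius function

-- The Möbius value read off a list of prime factors. `μ` itself is tied to the one list returned by
-- `factorise`; here any factorisation may be supplied.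
sign : List ℕ → ℤ
sign ps = if does (unique? ps) then -1ℤ ^ length ps else 0ℤ

μ≡sign : ∀ n .{{_ : NonZero n}} → μ n ≡ sign (factors (factorise n))
μ≡sign (suc n) = refl

sign-unique : ∀ {ps} → Unique ps → sign ps ≡ -1ℤ ^ length ps
sign-unique {ps} ps! = cong (if_then -1ℤ ^ length ps else 0ℤ) (dec-true (unique? ps) ps!)

sign-¬unique : ∀ {ps} → ¬ Unique ps → sign ps ≡ 0ℤ
sign-¬unique {ps} ¬ps! = cong (if_then -1ℤ ^ length ps else 0ℤ) (dec-false (unique? ps) ¬ps!)

-- Length and absence of repetitions are both invariant under permutation, so the order of the prime
-- factors is irrelevant.
sign-↭ : ∀ {ps qs} → ps ↭ qs → sign ps ≡ sign qs
sign-↭ {ps} {qs} p with unique? ps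
... | yes ps! = ≡-trans (cong (-1ℤ ^_) (↭-length p)) (sym (sign-unique (Unique-resp-↭ (↭⇒↭ₛ p) ps!)))
... | no ¬ps! = sym (sign-¬unique (¬ps! ∘ Unique-resp-↭ (↭⇒↭ₛ (↭-sym p))))

sign-∷-∈ : ∀ {p ps} → p ∈ ps → sign (p ∷ ps) ≡ 0ℤ
sign-∷-∈ {p} {ps} p∈ps = sign-¬unique {p ∷ ps} λ p∷ps! → Unique.Unique[x∷xs]⇒x∉xs p∷ps! p∈ps

-- A new entry keeps a duplicate-free list duplicate-free and lengthens it by one, which flips the
-- sign; if `ps` has a repetition, both sides are 0.
sign-∷-∉ : ∀ {p ps} → p ∉ ps → sign (p ∷ ps) ≡ - sign ps
sign-∷-∉ {p} {ps} p∉ps = case unique? ps of λ where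
    (yes ps!) → begin
      sign (p ∷ ps)           ≡⟨ sign-unique (All.¬Any⇒All¬ ps p∉ps ∷ ps!) ⟩
      -1ℤ * (-1ℤ ^ length ps) ≡⟨ ℤ.-1*i≡-i (-1ℤ ^ length ps) ⟩
      - (-1ℤ ^ length ps)     ≡⟨ cong -_ (sign-unique ps!) ⟨
      - sign ps               ∎
    (no ¬ps!) → begin
      sign (p ∷ ps) ≡⟨ sign-¬unique {p ∷ ps} (λ { (_ ∷ ps!) → ¬ps! ps! }) ⟩
      0ℤ            ≡⟨ cong -_ (sign-¬unique ¬ps!) ⟨
      - sign ps     ∎
  where open ≡-Reasoning

module _ {p} (pPrime : Prime p) where

  private
    instance
      p≢0 : NonZero p
      p≢0 = prime⇒nonZero pPrime

  open PrimeFactorisation using (isFactorisation; factorsPrime)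

  -- Putting `p` in front of the factors of `e` gives a prime factorisation of `p ℕ.* e`, and by
  -- uniqueness it is a permutation of the computed one.
  μ-prime-* : ∀ e .{{_ : NonZero e}} → μ (p ℕ.* e) ≡ sign (p ∷ factors (factorise e))
  μ-prime-* e = ≡-trans (μ≡sign (p ℕ.* e)) (sign-↭ (factorisationUnique (factorise (p ℕ.* e)) pe))
    where
    instance
      pe≢0 : NonZero (p ℕ.* e)
      pe≢0 = ℕ.m*n≢0 p e
    pe : PrimeFactorisation (p ℕ.* e)
    pe = record
      { factors         = p ∷ factors (factorise e)
      ; isFactorisation = cong (p ℕ.*_) (isFactorisation (factorise e))
      ; factorsPrime    = pPrime ∷ factorsPrime (factorise e)
      }

  -- A prime dividing a product of primes is one of them. This turns the case split on `p ∣ e` into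
  -- the one between `sign-∷-∈` and `sign-∷-∉`.
  ∣⇔∈-factors : ∀ e .{{_ : NonZero e}} → p ∣ e ⇔ p ∈ factors (factorise e)
  ∣⇔∈-factors e = mk⇔
    (λ p∣e → factorisationHasAllPrimeFactors pPrime
               (subst (p ∣_) (isFactorisation (factorise e)) p∣e) (factorsPrime (factorise e)))
    (λ p∈ → subst (p ∣_) (sym (isFactorisation (factorise e))) (∈⇒∣product p∈))

  μ-prime-*-∣ : ∀ {e} .{{_ : NonZero e}} → p ∣ e → μ (p ℕ.* e) ≡ 0ℤ
  μ-prime-*-∣ {e} p∣e = ≡-trans (μ-prime-* e) (sign-∷-∈ {p} {factors (factorise e)} (to (∣⇔∈-factors e) p∣e))

  μ-prime-*-∤ : ∀ {e} .{{_ : NonZero e}} → ¬ p ∣ e → μ (p ℕ.* e) ≡ - μ e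
  μ-prime-*-∤ {e} p∤e = begin
    μ (p ℕ.* e)                        ≡⟨ μ-prime-* e ⟩
    sign (p ∷ factors (factorise e))   ≡⟨ sign-∷-∉ (p∤e ∘ from (∣⇔∈-factors e)) ⟩
    - sign (factors (factorise e))     ≡⟨ cong -_ (μ≡sign e) ⟨
    - μ e                              ∎
    where open ≡-Reasoning

  ∑-μ-divisors-prime-* : ∀ m .{{_ : NonZero m}} → ∑ (divisors (p ℕ.* m)) μ ≡ 0ℤ
  ∑-μ-divisors-prime-* m = begin
    ∑ (divisors (p ℕ.* m)) μ
      ≡⟨ ∑-split (p ∣?_) (divisors (p ℕ.* m)) μ ⟩
    ∑ (filter (p ∣?_) (divisors (p ℕ.* m))) μ + ∑ (filter p∤? (divisors (p ℕ.* m))) μ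
      ≡⟨ cong₂ _+_
           (∑-set μ (Unique.filter⁺ (p ∣?_) (divisors⁺ (p ℕ.* m))) (Unique.map⁺ (ℕ.*-cancelˡ-≡ _ _ p) (divisors⁺ m))
             (mk⇔ multiples⇒ multiples⇐))
           (∑-set μ (Unique.filter⁺ p∤? (divisors⁺ (p ℕ.* m))) (Unique.filter⁺ p∤? (divisors⁺ m))
             (mk⇔ nonmultiples⇒ nonmultiples⇐)) ⟩
    ∑ (map (p ℕ.*_) (divisors m)) μ + ∑ (filter p∤? (divisors m)) μ
      ≡⟨ cong (_+ ∑ (filter p∤? (divisors m)) μ) ∑-multiples ⟩
    - ∑ (filter p∤? (divisors m)) μ + ∑ (filter p∤? (divisors m)) μ
      ≡⟨ ℤ.+-inverseˡ (∑ (filter p∤? (divisors m)) μ) ⟩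
    0ℤ
      ∎
    where
    open ≡-Reasoning
    instance
      pm≢0 : NonZero (p ℕ.* m)
      pm≢0 = ℕ.m*n≢0 p m

    p∤? : Decidable (λ d → ¬ p ∣ d)
    p∤? d = ¬? (p ∣? d)

    multiples⇒ : ∀ {d} → d ∈ filter (p ∣?_) (divisors (p ℕ.* m)) → d ∈ map (p ℕ.*_) (divisors m)
    -- The witness gives `d` as `q ℕ.* p`, hence the commutations; cancelling `p` from `p q ∣ p m`
    -- leaves `q ∣ m`.
    multiples⇒ d∈ with d∈pm , divides q refl ← ∈-filter⁻ (p ∣?_) {xs = divisors (p ℕ.* m)} d∈ =
      subst (_∈ map (p ℕ.*_) (divisors m)) (ℕ.*-comm p q)
        (∈-map⁺ (p ℕ.*_) (∈-divisors⁺ (*-cancelˡ-∣ p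
          (subst (_∣ p ℕ.* m) (ℕ.*-comm q p) (∈-divisors⁻ d∈pm)))))

    multiples⇐ : ∀ {d} → d ∈ map (p ℕ.*_) (divisors m) → d ∈ filter (p ∣?_) (divisors (p ℕ.* m))
    multiples⇐ d∈ with e , e∈m , refl ← ∈-map⁻ (p ℕ.*_) d∈ =
      ∈-filter⁺ (p ∣?_) (∈-divisors⁺ (*-monoʳ-∣ p (∈-divisors⁻ e∈m))) (m∣m*n e)

    prime-∤⇒coprime : ∀ {d} → ¬ p ∣ d → Coprime d p
    prime-∤⇒coprime p∤d (c∣d , c∣p) with prime⇒irreducible pPrime c∣p
    ... | inj₁ c≡1  = c≡1
    ... | inj₂ refl = contradiction c∣d p∤d

    -- Euclid's lemma: a divisor of `p m` that is coprime to `p` divides `m`.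
    nonmultiples⇒ : ∀ {d} → d ∈ filter p∤? (divisors (p ℕ.* m)) → d ∈ filter p∤? (divisors m)
    nonmultiples⇒ d∈ with d∈pm , p∤d ← ∈-filter⁻ p∤? {xs = divisors (p ℕ.* m)} d∈ =
      ∈-filter⁺ p∤? (∈-divisors⁺ (coprime-divisor (prime-∤⇒coprime p∤d) (∈-divisors⁻ d∈pm))) p∤d

    nonmultiples⇐ : ∀ {d} → d ∈ filter p∤? (divisors m) → d ∈ filter p∤? (divisors (p ℕ.* m))
    nonmultiples⇐ d∈ with d∈m , p∤d ← ∈-filter⁻ p∤? {xs = divisors m} d∈ =
      ∈-filter⁺ p∤? (∈-divisors⁺ (∣-trans (∈-divisors⁻ d∈m) (n∣m*n p))) p∤d

    μ-multiple : ∀ {e} → e ∈ divisors m → μ (p ℕ.* e) ≡ (if does (p∤? e) then - μ e else 0ℤ)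
    μ-multiple {e} e∈m with p ∣? e
    -- As a divisor of the nonzero `m`, `e` is nonzero, which the formulas for `μ (p ℕ.* e)`
    -- require.
    ... | yes p∣e = μ-prime-*-∣ {{>-nonZero (∣⇒>0 (∈-divisors⁻ e∈m))}} p∣e
    ... | no  p∤e = μ-prime-*-∤ {{>-nonZero (∣⇒>0 (∈-divisors⁻ e∈m))}} p∤e

    ∑-multiples : ∑ (map (p ℕ.*_) (divisors m)) μ ≡ - ∑ (filter p∤? (divisors m)) μ
    ∑-multiples = begin
      ∑ (map (p ℕ.*_) (divisors m)) μ
        ≡⟨ ∑-map (p ℕ.*_) (divisors m) μ ⟩
      ∑[ e ∈ divisors m ] (μ (p ℕ.* e))
        ≡⟨ ∑-cong (divisors m) μ-multiple ⟩
      ∑[ e ∈ divisors m ] (if does (p∤? e) then - μ e else 0ℤ)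
        ≡⟨ ∑-filter p∤? (divisors m) (λ e → - μ e) ⟨
      ∑[ e ∈ filter p∤? (divisors m) ] (- μ e)
        ≡⟨ ∑-neg (filter p∤? (divisors m)) μ ⟩
      - ∑ (filter p∤? (divisors m)) μ
        ∎

∑-μ-divisors-≢1 : ∀ n .{{_ : NonZero n}} → n ≢ 1 → ∑ (divisors n) μ ≡ 0ℤ
∑-μ-divisors-≢1 n n≢1 with factorise n
-- The empty product is 1. Otherwise the first factor serves as the prime `p` and the product of the
-- rest as `m`.
... | record { factors = [] ; isFactorisation = n≡1 } = contradiction n≡1 n≢1
... | record { factors = p ∷ ps ; isFactorisation = refl ; factorsPrime = pPrime ∷ _ } =
  ∑-μ-divisors-prime-* pPrime (product ps) {{ℕ.m*n≢0⇒n≢0 p}}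

∑-μ-divisors : ∀ n .{{_ : NonZero n}} → ∑ (divisors n) μ ≡ (if does (n ℕ.≟ 1) then 1ℤ else 0ℤ)
∑-μ-divisors 1               = refl
∑-μ-divisors n@(suc (suc _)) = ∑-μ-divisors-≢1 n λ ()

-- Coprime pairs

coprimes : ℕ → List ℕ → ℕ
coprimes n X = length (filter (λ x → gcd n x ℕ.≟ 1) X)

coprimes≡0⇔ : ∀ n X → coprimes n X ≡ 0 ⇔ All (λ x → gcd n x ≢ 1) X
coprimes≡0⇔ n = length-filter≡0⇔ (λ x → gcd n x ℕ.≟ 1)

-- By induction on `X`: a new element `x` contributes the sum of `μ` over the common divisors of `n`
-- and `x`, that is over the divisors of `gcd n x`, and this is 1 or 0 according to whether `x` is
-- coprime to `n`.
∑-divisors-μ*v : ∀ n X .{{_ : NonZero n}} → ∑[ d ∈ divisors n ] (μ d * + v X d) ≡ + coprimes n X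
∑-divisors-μ*v n []      = ≡-trans (∑-cong (divisors n) (λ {d} _ → ℤ.*-zeroʳ (μ d))) (∑-zero (divisors n))
∑-divisors-μ*v n (x ∷ X) = begin
  ∑[ d ∈ divisors n ] (μ d * + v (x ∷ X) d)
    ≡⟨ ∑-cong (divisors n) (λ {d} _ → pointwise d) ⟩
  ∑[ d ∈ divisors n ] ((if does (d ∣? x) then μ d else 0ℤ) + μ d * + v X d)
    ≡⟨ ∑-+ (divisors n) _ _ ⟩
  (∑[ d ∈ divisors n ] (if does (d ∣? x) then μ d else 0ℤ)) + (∑[ d ∈ divisors n ] (μ d * + v X d))
    ≡⟨ cong₂ _+_ (≡-trans (∑-divisors-gcd n x μ) (∑-μ-divisors (gcd n x) {{gcd≢0 n x}})) (∑-divisors-μ*v n X) ⟩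
  (if does (gcd n x ℕ.≟ 1) then 1ℤ else 0ℤ) + + coprimes n X
    ≡⟨ length-filter-∷ (λ x → gcd n x ℕ.≟ 1) x X ⟨
  + coprimes n (x ∷ X)
    ∎
  where
  open ≡-Reasoning
  pointwise : ∀ d → μ d * + v (x ∷ X) d ≡ (if does (d ∣? x) then μ d else 0ℤ) + μ d * + v X d
  -- The filter inside `v (x ∷ X) d` and the indicator branch on this same Boolean.
  pointwise d with does (d ∣? x)
  ... | true  = ℤ.*-suc (μ d) (+ v X d)
  ... | false = sym (ℤ.+-identityˡ _)

-- Each unordered pair of positions is counted once, at its earlier entry.
coprimePairs : List ℕ → ℕ
coprimePairs []      = 0
coprimePairs (x ∷ X) = coprimes x X ℕ.+ coprimePairs X

coprimePairs≡0⇔ : ∀ X → coprimePairs X ≡ 0 ⇔ AllPairs (λ x y → gcd x y ≢ 1) X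
coprimePairs≡0⇔ []      = mk⇔ (λ _ → []) (λ _ → refl)
coprimePairs≡0⇔ (x ∷ X) = mk⇔
  (λ eq → to (coprimes≡0⇔ x X) (ℕ.m+n≡0⇒m≡0 _ eq) ∷ to (coprimePairs≡0⇔ X) (ℕ.m+n≡0⇒n≡0 (coprimes x X) eq))
  (λ { (p ∷ ps) → cong₂ ℕ._+_ (from (coprimes≡0⇔ x X) p) (from (coprimePairs≡0⇔ X) ps) })

-- Used with `m` the Möbius value and `n` the old count of multiples: passing from n to n + 1 raises
-- n(n - 1) by 2n.
falling-suc : ∀ m n → m * (1ℤ + n) * ((1ℤ + n) - 1ℤ) ≡ + 2 * (m * n) + m * n * (n - 1ℤ)
falling-suc = solve-∀

-- The bound `M` stays fixed while `X` shrinks, because the tail of a list may have a smaller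
-- maximum. The increment from adding `x` lives on the divisors of `x`, all at most `M`, and equals
-- twice the number of entries of `X` coprime to `x`.
∑-μ*v*[v-1] : ∀ M X → All (λ x → 0 < x × x ≤ M) X →
  ∑[ d ∈ [1⋯ M ] ] (μ d * + v X d * (+ v X d - 1ℤ)) ≡ + 2 * + coprimePairs X
∑-μ*v*[v-1] M []      []                     =
  ≡-trans (∑-cong [1⋯ M ] (λ {d} _ → cong (_* (0ℤ - 1ℤ)) (ℤ.*-zeroʳ (μ d)))) (∑-zero [1⋯ M ])
∑-μ*v*[v-1] M (x ∷ X) ((x>0 , x≤M) ∷ X-bd) = begin
  ∑[ d ∈ [1⋯ M ] ] (μ d * + v (x ∷ X) d * (+ v (x ∷ X) d - 1ℤ))
    ≡⟨ ∑-cong [1⋯ M ] (λ {d} _ → pointwise d) ⟩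
  ∑[ d ∈ [1⋯ M ] ] ((if does (d ∣? x) then + 2 * (μ d * + v X d) else 0ℤ) + μ d * + v X d * (+ v X d - 1ℤ))
    ≡⟨ ∑-+ [1⋯ M ] _ _ ⟩
  (∑[ d ∈ [1⋯ M ] ] (if does (d ∣? x) then + 2 * (μ d * + v X d) else 0ℤ)) +
  (∑[ d ∈ [1⋯ M ] ] (μ d * + v X d * (+ v X d - 1ℤ)))
    ≡⟨ cong₂ _+_ (∑-[1⋯]-∣ x≤M _) (∑-μ*v*[v-1] M X X-bd) ⟩
  (∑[ d ∈ divisors x ] (+ 2 * (μ d * + v X d))) + + 2 * + coprimePairs X
    ≡⟨ cong (_+ _) (∑-*ˡ (divisors x) (+ 2) _) ⟩
  + 2 * (∑[ d ∈ divisors x ] (μ d * + v X d)) + + 2 * + coprimePairs X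
    ≡⟨ cong (λ s → + 2 * s + _) (∑-divisors-μ*v x X) ⟩
  + 2 * + coprimes x X + + 2 * + coprimePairs X
    ≡⟨ ℤ.*-distribˡ-+ (+ 2) (+ coprimes x X) (+ coprimePairs X) ⟨
  + 2 * + coprimePairs (x ∷ X)
    ∎
  where
  open ≡-Reasoning
  instance
    x≢0 : NonZero x
    x≢0 = >-nonZero x>0
  pointwise : ∀ d → μ d * + v (x ∷ X) d * (+ v (x ∷ X) d - 1ℤ) ≡
    (if does (d ∣? x) then + 2 * (μ d * + v X d) else 0ℤ) + μ d * + v X d * (+ v X d - 1ℤ)
  pointwise d with does (d ∣? x)
  ... | true  = falling-suc (μ d) (+ v X d)
  ... | false = sym (ℤ.+-identityˡ _)

-- Families indexed by Fin k

AllPairs-tabulate⁻ : ∀ {R : A → A → Set} {k} {f : Fin k → A} →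
  AllPairs R (tabulate f) → ∀ i j → i <ᶠ j → R (f i) (f j)
AllPairs-tabulate⁻ (r ∷ _)  zero    (suc j) _         = All.tabulate⁻ r j
AllPairs-tabulate⁻ (_ ∷ rs) (suc i) (suc j) (s≤s i<j) = AllPairs-tabulate⁻ rs i j i<j

All-take-tabulate⇔ : ∀ {P : A → Set} {k} (f : Fin k → A) (j : Fin k) →
  All P (take (toℕ j) (tabulate f)) ⇔ (∀ i → i <ᶠ j → P (f i))
All-take-tabulate⇔ f zero    = mk⇔ (λ _ _ ()) (λ _ → [])
All-take-tabulate⇔ f (suc j) = mk⇔
  (λ { (p ∷ ps) zero _ → p ; (p ∷ ps) (suc i) (s≤s i<j) → to (All-take-tabulate⇔ (f ∘ suc) j) ps i i<j })
  (λ p → p zero (s≤s z≤n) ∷ from (All-take-tabulate⇔ (f ∘ suc) j) (λ i i<j → p (suc i) (s≤s i<j)))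

-- Distinctness is asked of the values, as in (a); for an injective family it agrees with
-- distinctness of the indices.
NoCoprimePair : ∀ {k} → (Fin k → ℕ) → Set
NoCoprimePair f = ∀ i j → f i ≢ f j → gcd (f i) (f j) > 1

module _ {k} (f : Fin k → ℕ) (f-injective : Injective _≡_ _≡_ f) (f>0 : ∀ i → 0 < f i) where

  -- The gcd is symmetric, so ordered indices suffice. Injectivity makes their values distinct, and
  -- positivity excludes gcd 0, so that being different from 1 means exceeding 1.
  noCoprimePair⇔< : NoCoprimePair f ⇔ (∀ i j → i <ᶠ j → gcd (f i) (f j) ≢ 1)
  noCoprimePair⇔< = mk⇔
    (λ gcd>1 i j i<j → ℕ.>⇒≢ (gcd>1 i j (<⇒≢ i<j ∘ f-injective)))
    ⇐
    where
    gcd≢1⇒gcd>1 : ∀ i j → gcd (f i) (f j) ≢ 1 → gcd (f i) (f j) > 1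
    gcd≢1⇒gcd>1 i j gcd≢1 = ℕ.≤∧≢⇒<
      (ℕ.n≢0⇒n>0 (ℕ.<⇒≢ (f>0 i) ∘ sym ∘ gcd[m,n]≡0⇒m≡0)) (gcd≢1 ∘ sym)
    ⇐ : (∀ i j → i <ᶠ j → gcd (f i) (f j) ≢ 1) → NoCoprimePair f
    ⇐ gcd≢1 i j fi≢fj with <-cmp i j
    ... | tri< i<j _ _  = gcd≢1⇒gcd>1 i j (gcd≢1 i j i<j)
    ... | tri≈ _ refl _ = contradiction refl fi≢fj
    ... | tri> _ _ j<i  = gcd≢1⇒gcd>1 i j (gcd≢1 j i j<i ∘ ≡-trans (gcd-comm (f j) (f i)))

  noCoprimePair⇔∑v[v-1] : NoCoprimePair f ⇔
    (∑[ d ∈ [1⋯ max 0 (tabulate f) ] ] (μ d * + v (tabulate f) d * (+ v (tabulate f) d - 1ℤ)) ≡ 0ℤ)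
  noCoprimePair⇔∑v[v-1] = mk⇔
    (λ h → ≡-trans ∑≡ (cong (λ c → + 2 * + c)
      (from (coprimePairs≡0⇔ F) (tabulate⁺-< λ {i} {j} → to noCoprimePair⇔< h i j))))
    -- The factor 2 cancels, leaving the number of coprime pairs equal to 0.
    (λ eq → from noCoprimePair⇔< (AllPairs-tabulate⁻ (to (coprimePairs≡0⇔ F)
      (ℤ.+-injective (ℤ.*-cancelˡ-≡ (+ 2) _ _ (≡-trans (sym ∑≡) eq))))))
    where
    F : List ℕ
    F = tabulate f
    ∑≡ : ∑[ d ∈ [1⋯ max 0 F ] ] (μ d * + v F d * (+ v F d - 1ℤ)) ≡ + 2 * + coprimePairs F
    -- All entries are positive, so the base value 0 never exceeds an entry, and `xs≤max` supplies
    -- the upper bound for each.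
    ∑≡ = ∑-μ*v*[v-1] (max 0 F) F (All.zip (All.tabulate⁺ f>0 , xs≤max 0 F))

  -- The inner sum at `j` counts the earlier entries coprime to `f j`. These counts are nonnegative,
  -- so the total vanishes only if each does. The count uses the gcd with the later entry first,
  -- hence the uses of `gcd-comm`.
  noCoprimePair⇔∑∑v : NoCoprimePair f ⇔
    (∑[ j ∈ allFin k ] ∑[ d ∈ divisors (f j) ] (μ d * + v (take (toℕ j) (tabulate f)) d) ≡ 0ℤ)
  noCoprimePair⇔∑∑v = mk⇔
    (λ h → ≡-trans ∑≡ (cong +_ (from (sum≡0⇔All≡0 (map c (allFin k))) (All.map⁺ (All.tabulate⁺ λ j →
      from (coprimes≡0⇔ (f j) _) (from (All-take-tabulate⇔ f j) λ i i<j →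
        to noCoprimePair⇔< h i j i<j ∘ ≡-trans (gcd-comm (f i) (f j))))))))
    (λ eq → from noCoprimePair⇔< λ i j i<j →
      to (All-take-tabulate⇔ f j) (to (coprimes≡0⇔ (f j) _)
        (All.tabulate⁻ (All.map⁻ (to (sum≡0⇔All≡0 (map c (allFin k)))
          (ℤ.+-injective (≡-trans (sym ∑≡) eq)))) j)) i i<j ∘ ≡-trans (gcd-comm (f j) (f i)))
    where
    c : Fin k → ℕ
    c j = coprimes (f j) (take (toℕ j) (tabulate f))
    ∑≡ : ∑[ j ∈ allFin k ] ∑[ d ∈ divisors (f j) ] (μ d * + v (take (toℕ j) (tabulate f)) d) ≡
      + sum (map c (allFin k))
    ∑≡ = ≡-trans
      (∑-cong (allFin k) (λ {j} _ → ∑-divisors-μ*v (f j) (take (toℕ j) (tabulate f)) {{>-nonZero (f>0 j)}}))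
      (∑-pos (allFin k) c)

module _ {k} (τ : Permutation′ k) where

  permutation-injective : Injective _≡_ _≡_ (τ ⟨$⟩ʳ_)
  permutation-injective {i} {j} eq =
    ≡-trans (sym (inverseˡ τ)) (≡-trans (cong (τ ⟨$⟩ˡ_) eq) (inverseˡ τ))

  -- The condition ranges over all pairs of indices, so a bijection only relabels them; the converse
  -- evaluates at preimages under `τ`.
  noCoprimePair-permute : (a : Fin k → ℕ) → NoCoprimePair a ⇔ NoCoprimePair (a ∘ (τ ⟨$⟩ʳ_))
  noCoprimePair-permute a = mk⇔
    (λ h i j → h (τ ⟨$⟩ʳ i) (τ ⟨$⟩ʳ j))
    (λ h i j → subst₂ (λ i j → a i ≢ a j → gcd (a i) (a j) > 1) (inverseʳ τ) (inverseʳ τ)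
      (h (τ ⟨$⟩ˡ i) (τ ⟨$⟩ˡ j)))

theorem5p7 : (k : ℕ) → 1 ≤ k →
  (a : Fin k → ℕ) → Injective _≡_ _≡_ a → (∀ i → 0 < a i) →
  (τ : Permutation′ k) →
  let
    A : List ℕ
    A = tabulate a
    -- the set { a_τ(1), …, a_τ(m) }
    Aτ : ℕ → List ℕ
    Aτ m = take m (tabulate (λ i → a (τ ⟨$⟩ʳ i)))
    a-holds : Set
    a-holds = ∀ i j → a i ≢ a j → gcd (a i) (a j) > 1
    b-holds : Set
    b-holds = ∑[ d ∈ [1⋯ max 0 A ] ] (μ d * + v A d * (+ v A d - 1ℤ)) ≡ 0ℤ
    -- j : Fin k counts from 0, so the elements preceding a_τ(j) form Aτ (toℕ j)
    c-holds : Set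
    c-holds = ∑[ j ∈ allFin k ] ∑[ d ∈ divisors (a (τ ⟨$⟩ʳ j)) ] (μ d * + v (Aτ (toℕ j)) d) ≡ 0ℤ
  in (a-holds ⇔ b-holds) × (b-holds ⇔ c-holds)
theorem5p7 k _ a a-injective a>0 τ = a⇔b , a⇔c ⇔-∘ ⇔-sym a⇔b
  where
  a⇔b = noCoprimePair⇔∑v[v-1] a a-injective a>0
  -- Statement (c) is about the reordered family, which is again injective and positive; (a) is
  -- carried over to it by relabelling.
  a⇔c = noCoprimePair⇔∑∑v (a ∘ (τ ⟨$⟩ʳ_)) (permutation-injective τ ∘ a-injective) (a>0 ∘ (τ ⟨$⟩ʳ_))
    ⇔-∘ noCoprimePair-permute τ a
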